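{- There exist instances of the Machine-Loads-Identical-Jobs (MLIJ) problem on $d$ machines (for a sequence of $d$ tending to infinity) for which: (1) there is an $O(1)$-approximate portfolio $X$ of size $2$ for the class of top-$k$ norms; and (2) any $O(1)$-approximate portfolio $X'$ for the class of ordered norms has size $\Omega\left(\frac{\log d}{\log\log d}\right)$. Explicitly: there are an absolute constant $C\ge1$ and a family of MLIJ instances with $d\to\infty$ such that each instance in the family has a $C$-approximate portfolio of size $2$ for top-$k$ norms, while for every constant $\alpha\ge 1$ there is $c>0$ such that, for all instances in the family with $d$ sufficiently large, every $\alpha$-approximate portfolio for ordered norms has size at least $c\,\frac{\log d}{\log\log d}$.
   Context: MLIJ: an instance consists of $n\ge 1$ copies of a job and $d$ machines with processing times $p_1,\dots,p_d>0$. A schedule assigns $n_i\in\mathbb{Z}_{\ge 0}$ jobs to machine $i$ with $\sum_{i=1}^d n_i=n$; its load vector is $(n_1p_1,\dots,n_dp_d)\in\mathbb{R}^d_{\ge 0}$. The set $\mathcal{D}$ of feasible vectors is the set of all such load vectors. Norms: for $x\in\mathbb{R}^d$, $|x|^{\downarrow}$ is the vector of absolute values of coordinates of $x$ sorted in decreasing order. For $k\in\{1,\dots,d\}$ the top-$k$ norm of $x$ is $\sum_{i=1}^k|x|^{\downarrow}_i$. A weight vector is a nonzero $w\in\mathbb{R}^d$ with $w_1\ge\dots\ge w_d\ge 0$; the ordered norm is $\|x\|_{(w)}=w^\top|x|^{\downarrow}$. Portfolio: given $\mathcal{D}$, a class $\mathbf{C}$ of functions $\mathcal{D}\to\mathbb{R}_{\ge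 0}$ and $\alpha\ge 1$, a set $X\subseteq\mathcal{D}$ is an $\alpha$-approximate portfolio for $\mathbf{C}$ over $\mathcal{D}$ if $\min_{x\in X}f(x)\le\alpha\min_{x\in\mathcal{D}}f(x)$ for every $f\in\mathbf{C}$. -}

module Defs where

open import Level using (Level) renaming (suc to lsuc; _⊔_ to _⊔ˡ_)
open import Algebra.Bundles using (CommutativeRing)
open import Algebra.Structures using (IsCommutativeRing)
open import Data.Nat.Base as ℕ using (ℕ)
open import Data.Fin.Base as Fin using ()
open import Data.List.Base as List using (List)
import Data.List.Sort as Sort
open import Data.List.Membership.Propositional using () renaming (_∈_ to _∈ˡ_)
open import Data.List.Relation.Unary.Unique.Propositional using (Unique)
open import Data.Product.Base using (∃; ∃₂; _×_)
open import Data.Vec.Base as Vec using (Vec; lookup; replicate; toList; zipWith)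
open import Relation.Binary.Bundles using (DecTotalOrder)
open import Relation.Binary.Structures using (IsDecTotalOrder)
import Relation.Binary.Construct.Flip.EqAndOrd as Flip
open import Relation.Binary.PropositionalEquality using (_≡_; _≢_)
open import Relation.Unary using (Pred; _∈_; _⊆_)

-- The standard library has no real numbers.  Everything below is stated over
-- an arbitrary Archimedean totally ordered field, of which ℝ (classically) and
-- ℚ are instances; completeness of ℝ is not needed, and a statement about all
-- such fields contains the statement about ℝ.

record OrderedField (a ℓ : Level) : Set (lsuc (a ⊔ˡ ℓ)) where
  infix  8 -_
  infixl 7 _*_
  infixl 6 _+_
  infix  4 _≤_ _<_
  field
    Carrier           : Set a
    _+_ _*_           : Carrier → Carrier → Carrier
    -_                : Carrier → Carrier
    0# 1#             : Carrier
    _≤_               : Carrier → Carrier → Set ℓ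
    isCommutativeRing : IsCommutativeRing _≡_ _+_ _*_ -_ 0# 1#
    isDecTotalOrder   : IsDecTotalOrder _≡_ _≤_
    0≢1               : 0# ≢ 1#
    inverse           : ∀ x → x ≢ 0# → ∃ λ y → x * y ≡ 1#
    +-monoʳ-≤         : ∀ x {y z} → y ≤ z → x + y ≤ x + z
    *-nonNegative     : ∀ {x y} → 0# ≤ x → 0# ≤ y → 0# ≤ x * y

  _<_ : Carrier → Carrier → Set (a ⊔ˡ ℓ)
  x < y = x ≤ y × x ≢ y

  commutativeRing : CommutativeRing a a
  commutativeRing = record { isCommutativeRing = isCommutativeRing }

  decTotalOrder : DecTotalOrder a a ℓ
  decTotalOrder = record { isDecTotalOrder = isDecTotalOrder }

  open import Algebra.Definitions.RawMonoid
    (CommutativeRing.+-rawMonoid commutativeRing) public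
    using () renaming (_×_ to _·_)

  fromℕ : ℕ → Carrier
  fromℕ n = n · 1#

record ArchimedeanOrderedField (a ℓ : Level) : Set (lsuc (a ⊔ˡ ℓ)) where
  field
    orderedField : OrderedField a ℓ
  open OrderedField orderedField public
  field
    archimedean : ∀ x → ∃ λ n → x ≤ fromℕ n

module MLIJ {a ℓ} (R : ArchimedeanOrderedField a ℓ) where
  open ArchimedeanOrderedField R

  record Instance : Set (a ⊔ˡ ℓ) where
    field
      n   : ℕ
      n≥1 : 1 ℕ.≤ n
      d   : ℕ
      p   : Vec Carrier d
      p>0 : ∀ i → 0# < lookup p i

  loadVector : ∀ {d} → Vec ℕ d → Vec Carrier d → Vec Carrier d
  loadVector = zipWith _·_

  Feasible : (I : Instance) → Pred (Vec Carrier (Instance.d I)) a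
  Feasible I x = ∃ λ (s : Vec ℕ d) → Vec.sum s ≡ n × x ≡ loadVector s p
    where open Instance I

  open import Algebra.Construct.NaturalChoice.Max
    (DecTotalOrder.totalOrder decTotalOrder) using (_⊔_)
  open Sort (Flip.decTotalOrder decTotalOrder) using ()
    renaming (sort to sortDecreasing)

  ∣_∣ : Carrier → Carrier
  ∣ x ∣ = x ⊔ (- x)

  ∣_∣↓ : ∀ {d} → Vec Carrier d → List Carrier
  ∣ x ∣↓ = sortDecreasing (List.map ∣_∣ (toList x))

  sum : List Carrier → Carrier
  sum = List.foldr _+_ 0#

  topNorm : ∀ {d} → ℕ → Vec Carrier d → Carrier
  topNorm k x = sum (List.take k ∣ x ∣↓)

  orderedNorm : ∀ {d} → Vec Carrier d → Vec Carrier d → Carrier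
  orderedNorm w x = sum (List.zipWith _*_ (toList w) ∣ x ∣↓)

  record IsWeight {d} (w : Vec Carrier d) : Set (a ⊔ˡ ℓ) where
    field
      nonzero     : w ≢ replicate d 0#
      decreasing  : ∀ {i j} → i Fin.≤ j → lookup w j ≤ lookup w i
      nonNegative : ∀ i → 0# ≤ lookup w i

  FunctionClass : ℕ → Set (lsuc (a ⊔ˡ ℓ))
  FunctionClass d = Pred (Vec Carrier d → Carrier) (a ⊔ˡ ℓ)

  data TopKNorms (d : ℕ) : FunctionClass d where
    top : ∀ k → 1 ℕ.≤ k → k ℕ.≤ d → topNorm k ∈ TopKNorms d

  data OrderedNorms (d : ℕ) : FunctionClass d where
    ordered : ∀ w → IsWeight w → orderedNorm w ∈ OrderedNorms d

  record IsMinimum {b s} {A : Set b} (f : A → Carrier) (S : Pred A s)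
                   (m : Carrier) : Set (a ⊔ˡ b ⊔ˡ s ⊔ˡ ℓ) where
    field
      attained   : ∃ λ x → x ∈ S × f x ≡ m
      lowerBound : ∀ {x} → x ∈ S → m ≤ f x

  -- A feasible set is finite, so its subsets are given by duplicate-free lists,
  -- and the size of a portfolio is the length of its list.
  record IsPortfolio (I : Instance) (C : FunctionClass (Instance.d I))
                     (α : Carrier) (X : List (Vec Carrier (Instance.d I)))
                     : Set (lsuc (a ⊔ˡ ℓ)) where
    field
      unique      : Unique X
      feasible    : (_∈ˡ X) ⊆ Feasible I
      approximate : ∀ {f} → f ∈ C → ∃₂ λ m m* →
                    IsMinimum f (_∈ˡ X) m × IsMinimum f (Feasible I) m* × m ≤ α * m*

-- For q ≥ 2 take, for each i ≤ L, a group of q²ⁱ machines with processing time qⁱ,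
-- and q²ᴸ jobs.  Spreading the n jobs evenly over group j gives load n / qʲ on
-- each of its q²ʲ machines.
--
-- Top-k norms: if t is the k-th largest load, the top-k norm is k t + Σ (x ∸ t), while
-- the n jobs number at most 2 qᴸ t + Σ (x ∸ t).  So every schedule has top-k norm at
-- least min (n , k qᴸ / 2); the schedules spread over group 0 and over group L have
-- top-k norm at most n and k qᴸ.
--
-- Ordered norms: the weight (q²ʲ , 1 , … , 1) is, up to a factor 2, the maximum of
-- q²ʲ max x and Σ x, and spreading over group j costs at most 2 n qʲ.  A schedule
-- that is b-approximate for j has total load at most 2 b n qʲ, so it places few jobs
-- in slower groups, and maximum load at most 2 b n / qʲ, so it places few jobs in
-- faster ones.  For q > 6 b it therefore serves only one j, and L + 1 schedules are
-- needed.  Letting q = L = 2ᵐ⁺¹ grow makes this work for every b at once, with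
-- log d of order L log L.

module Submission where

open import Defs
open import Algebra.Bundles using (module CommutativeRing)
import Algebra.Properties.CommutativeSemigroup
open import Data.Fin.Base as Fin using (Fin; zero; suc; toℕ)
import Data.Fin.Properties as Fin
open import Data.List.Base as List using (List; []; _∷_; length; map; take; upTo; downFrom; filter; cartesianProductWith)
open import Data.List.Membership.Propositional using (_∈_)
open import Data.List.Membership.Propositional.Properties
  using (∈-map⁺; ∈-map⁻; ∈-filter⁺; ∈-filter⁻; ∈-upTo⁺; ∈-downFrom⁺; ∈-cartesianProductWith⁺)
open import Data.List.Membership.Setoid.Properties using (index-injective)
open import Data.List.Properties using (map-++; map-id; map-cong; map-injective; take-map)
open import Data.List.Relation.Binary.Permutation.Propositional using (_↭_; ↭-sym)
import Data.List.Relation.Binary.Permutation.Propositional.Properties as Perm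
open import Data.List.Relation.Unary.All as All using (All; []; _∷_)
import Data.List.Relation.Unary.All.Properties as All
open import Data.List.Relation.Unary.AllPairs as AllPairs using (AllPairs; []; _∷_)
import Data.List.Relation.Unary.AllPairs.Properties as AllPairs
open import Data.List.Relation.Unary.Any as Any using (here; there)
open import Data.List.Relation.Unary.Sorted.TotalOrder.Properties using (Sorted⇒AllPairs)
open import Data.List.Relation.Unary.Unique.Propositional using (Unique)
import Data.List.Sort as Sort
open import Data.Nat.Base as ℕ using (ℕ; zero; suc)
import Data.Nat.ListAction as ℕ
open import Data.Nat.ListAction.Properties using (sum-++; sum-↭)
open import Data.Nat.Logarithm
import Data.Nat.Properties as ℕ
open import Data.Nat.Tactic.RingSolver using (solve-∀)
open import Data.Product.Base using (∃; Σ-syntax; ∃-syntax; _×_; _,_; proj₁; proj₂)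
open import Data.Sum.Base using (inj₁; inj₂)
open import Data.Vec.Base as Vec using (Vec; []; _∷_; replicate; toList; zipWith; lookup)
open import Data.Vec.Membership.Propositional.Properties using (∈-lookup)
import Data.Vec.Properties as Vec
import Data.Vec.Relation.Unary.All as VecAll
import Data.Vec.Relation.Unary.All.Properties as VecAll
open import Function.Base using (_∘_)
open import Relation.Binary.Bundles using (module DecTotalOrder)
import Relation.Binary.Construct.Flip.EqAndOrd as Flip
open import Relation.Binary.Definitions using (tri<; tri≈; tri>)
open import Relation.Binary.PropositionalEquality
open import Relation.Nullary using (yes; no; contradiction)

open Algebra.Properties.CommutativeSemigroup ℕ.*-commutativeSemigroup using ()
  renaming (interchange to *-interchange)

module Combinatorics where

  open import Data.Nat.Base
  open import Data.Nat.ListAction using (sum)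
  open import Data.Nat.Properties
  open Algebra.Properties.CommutativeSemigroup +-commutativeSemigroup using (interchange)

  -- Loads on machines arranged in groups of equal processing time.

  loads : ∀ {d} → Vec ℕ d → Vec ℕ d → List ℕ
  loads s P = toList (zipWith _*_ s P)

  loads-++ : ∀ {m n} (s P : Vec ℕ m) (s′ P′ : Vec ℕ n) →
             loads (s Vec.++ s′) (P Vec.++ P′) ≡ loads s P List.++ loads s′ P′
  loads-++ s P s′ P′ = trans (cong toList (Vec.zipWith-++ _*_ s s′ P P′)) (Vec.toList-++ (zipWith _*_ s P) _)

  -- A list `ps` encodes an instance: each entry `p` stands for a group of `p * p` machines with
  -- processing time `p`.
  size : List ℕ → ℕ
  size []       = 0
  size (p ∷ ps) = p * p + size ps

  machines : (ps : List ℕ) → Vec ℕ (size ps)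
  machines []       = []
  machines (p ∷ ps) = replicate (p * p) p Vec.++ machines ps

  -- Bounding the number of jobs by the loads, group by group.

  sum-map-++ : ∀ (h : ℕ → ℕ) xs ys → sum (map h (xs List.++ ys)) ≡ sum (map h xs) + sum (map h ys)
  sum-map-++ h xs ys = trans (cong sum (map-++ h xs ys)) (sum-++ (map h xs) (map h ys))

  sum-map-zero : ∀ (h : ℕ → ℕ) {xs} → All (λ x → h x ≡ 0) xs → sum (map h xs) ≡ 0
  sum-map-zero h []         = refl
  sum-map-zero h (eq ∷ eqs) = cong₂ _+_ eq (sum-map-zero h eqs)

  sum-map-+ : ∀ (g h : ℕ → ℕ) xs → sum (map (λ x → g x + h x) xs) ≡ sum (map g xs) + sum (map h xs)
  sum-map-+ g h []       = refl
  sum-map-+ g h (x ∷ xs) rewrite sum-map-+ g h xs = interchange (g x) (h x) (sum (map g xs)) (sum (map h xs))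

  sum-map-*ʳ : ∀ (h : ℕ → ℕ) k xs → sum (map (λ x → h x * k) xs) ≡ sum (map h xs) * k
  sum-map-*ʳ h k []       = refl
  sum-map-*ʳ h k (x ∷ xs) = trans (cong (h x * k +_) (sum-map-*ʳ h k xs)) (sym (*-distribʳ-+ k (h x) _))

  block-bound : ∀ {m} r p c (h : ℕ → ℕ) → (∀ x → r * x ≤ h (x * p) + c) → (s : Vec ℕ m) →
                r * Vec.sum s ≤ sum (map h (loads s (replicate m p))) + m * c
  block-bound r p c h hyp []           = ≤-reflexive (*-zeroʳ r)
  block-bound {suc m} r p c h hyp (x ∷ s) = begin
    r * (x + Vec.sum s)           ≡⟨ *-distribˡ-+ r x _ ⟩
    r * x + r * Vec.sum s         ≤⟨ +-mono-≤ (hyp x) (block-bound r p c h hyp s) ⟩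
    h (x * p) + c + (E + m * c)   ≡⟨ interchange (h (x * p)) c E (m * c) ⟩
    h (x * p) + E + (c + m * c)   ∎
    where
    open ≤-Reasoning
    E = sum (map h (loads s (replicate m p)))

  -- Jobs in one group are charged to its loads through `h`, up to an allowance `b p` that depends
  -- on the group alone. The factor `r` clears denominators.
  GroupBound : ℕ → (h b : ℕ → ℕ) → ℕ → Set
  GroupBound r h b p = (s : Vec ℕ (p * p)) →
                       r * Vec.sum s ≤ sum (map h (loads s (replicate (p * p) p))) + b p

  groups-bound : ∀ {r h b} ps → All (GroupBound r h b) ps → (s : Vec ℕ (size ps)) →
                 r * Vec.sum s ≤ sum (map h (loads s (machines ps))) + sum (map b ps)
  groups-bound {r} [] [] [] = ≤-reflexive (*-zeroʳ r)
  groups-bound {r} {h} {b} (p ∷ ps) (bound ∷ bounds) s with Vec.splitAt (p * p) s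
  ... | s₁ , s₂ , refl = begin
    r * Vec.sum (s₁ Vec.++ s₂)            ≡⟨ cong (r *_) (Vec.sum-++ s₁) ⟩
    r * (Vec.sum s₁ + Vec.sum s₂)         ≡⟨ *-distribˡ-+ r (Vec.sum s₁) _ ⟩
    r * Vec.sum s₁ + r * Vec.sum s₂       ≤⟨ +-mono-≤ (bound s₁) (groups-bound {r} {h} {b} ps bounds s₂) ⟩
    E₁ + b p + (E₂ + sum (map b ps))      ≡⟨ interchange E₁ (b p) E₂ _ ⟩
    E₁ + E₂ + (b p + sum (map b ps))      ≡⟨ cong (_+ _) (sum-map-++ h l₁ l₂) ⟨
    sum (map h (l₁ List.++ l₂)) + _       ≡⟨ cong (λ l → sum (map h l) + _) (loads-++ s₁ _ s₂ _) ⟨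
    sum (map h (loads (s₁ Vec.++ s₂) (machines (p ∷ ps)))) + (b p + sum (map b ps)) ∎
    where
    open ≤-Reasoning
    l₁ = loads s₁ (replicate (p * p) p)
    l₂ = loads s₂ (machines ps)
    E₁ = sum (map h l₁)
    E₂ = sum (map h l₂)

  -- Up to load W / r each of the p² machines processes W / (r p) jobs, hence the
  -- term p W; the excess of a load y over W / r is at most that many further jobs.
  excess-bound : ∀ r W p → 1 ≤ p → GroupBound r (λ y → r * y ∸ W) (_* W) p
  excess-bound r W p 1≤p s = *-cancelˡ-≤ p (begin
    p * (r * Vec.sum s)           ≡⟨ *-assoc p r _ ⟨
    p * r * Vec.sum s             ≤⟨ block-bound (p * r) p W (λ y → (r * y ∸ W) * p) single s ⟩
    sum (map (λ y → (r * y ∸ W) * p) l) + p * p * W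
                                  ≡⟨ cong₂ _+_ (sum-map-*ʳ (λ y → r * y ∸ W) p l) (*-assoc p p W) ⟩
    E * p + p * (p * W)           ≡⟨ cong (_+ p * (p * W)) (*-comm E p) ⟩
    p * E + p * (p * W)           ≡⟨ *-distribˡ-+ p E (p * W) ⟨
    p * (E + p * W)               ∎)
    where
    open ≤-Reasoning
    instance _ = >-nonZero 1≤p
    l = loads s (replicate (p * p) p)
    E = sum (map (λ y → r * y ∸ W) l)
    rotate : ∀ p r x → p * r * x ≡ r * (x * p)
    rotate = solve-∀
    single : ∀ x → p * r * x ≤ (r * (x * p) ∸ W) * p + W
    single x = begin
      p * r * x                     ≡⟨ rotate p r x ⟩
      r * (x * p)                   ≤⟨ m≤n+m∸n _ W ⟩
      W + (r * (x * p) ∸ W)         ≤⟨ +-monoʳ-≤ W (m≤m*n _ p) ⟩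
      W + (r * (x * p) ∸ W) * p     ≡⟨ +-comm W _ ⟩
      (r * (x * p) ∸ W) * p + W     ∎

  -- In a slow group every job adds `p`, hence at least `r`, to the load, so no allowance arises.
  load-bound : ∀ r p → r ≤ p → GroupBound r (λ y → y) (λ _ → 0) p
  load-bound r p r≤p s = ≤-trans
    (block-bound r p 0 (λ y → y) (λ x → ≤-trans (≤-reflexive (*-comm r x)) (≤-trans (*-monoʳ-≤ x r≤p) (m≤m+n _ 0))) s)
    (+-monoʳ-≤ _ (≤-reflexive (*-zeroʳ (p * p))))

  sum-map-mono : ∀ {g h : ℕ → ℕ} → (∀ x → g x ≤ h x) → ∀ xs → sum (map g xs) ≤ sum (map h xs)
  sum-map-mono g≤h []       = z≤n
  sum-map-mono g≤h (x ∷ xs) = +-mono-≤ (g≤h x) (sum-map-mono g≤h xs)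

  -- Keeps only the groups faster than `r`, the ones that are charged an allowance.
  below : ℕ → ℕ → ℕ
  below r p with p <? r
  ... | yes _ = p
  ... | no  _ = 0

  below-≤ : ∀ r p → below r p ≤ p
  below-≤ r p with p <? r
  ... | yes _ = ≤-refl
  ... | no  _ = z≤n

  -- Groups with `p < r` are bounded through `excess-bound`, where the load limit `W / r` leaves no
  -- excess; the other groups are bounded through `load-bound`.
  sum-below-bound : ∀ r W ps → All (1 ≤_) ps → (s : Vec ℕ (size ps)) →
    All (λ y → r * y ≤ W) (loads s (machines ps)) →
    r * Vec.sum s ≤ sum (loads s (machines ps)) + sum (map (below r) ps) * W
  sum-below-bound r W ps 1≤ps s light = begin
    r * Vec.sum s                           ≤⟨ groups-bound {r} {h} {b} ps (All.map (λ {p} → group p) 1≤ps) s ⟩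
    sum (map h l) + sum (map b ps)          ≡⟨ cong₂ _+_ (sum-map-+ (λ y → y) (λ y → r * y ∸ W) l) (sum-map-*ʳ (below r) W ps) ⟩
    sum (map (λ y → y) l) + sum (map (λ y → r * y ∸ W) l) + B
      ≡⟨ cong₂ (λ x y → x + y + B) (cong sum (map-id l)) (sum-map-zero _ (All.map m≤n⇒m∸n≡0 light)) ⟩
    sum l + 0 + B                           ≡⟨ cong (_+ B) (+-identityʳ _) ⟩
    sum l + B                               ∎
    where
    open ≤-Reasoning
    l = loads s (machines ps)
    h b : ℕ → ℕ
    -- `groups-bound` wants one `h` for all groups, so the charges of the fast and the slow case are
    -- added; the second summand vanishes by `light`.
    h y = y + (r * y ∸ W)
    b p = below r p * W
    B = sum (map (below r) ps) * W
    group : ∀ p → 1 ≤ p → GroupBound r h b p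
    group p 1≤p s with p <? r
    ... | yes _  = ≤-trans (excess-bound r W p 1≤p s)
                     (+-monoˡ-≤ (p * W) (sum-map-mono (λ y → m≤n+m (r * y ∸ W) y) (loads s (replicate (p * p) p))))
    ... | no p≮r = ≤-trans (load-bound r p (≮⇒≥ p≮r) s)
                     (+-monoˡ-≤ 0 (sum-map-mono (λ y → m≤m+n y (r * y ∸ W)) (loads s (replicate (p * p) p))))

  -- Schedules spread evenly over one group.

  -- The membership proof locates the group inside `machines ps`, so recursion on it builds the
  -- schedule.
  spread : ∀ {p ps} → ℕ → p ∈ ps → Vec ℕ (size ps)
  spread {ps = p ∷ ps} k (here _)  = replicate (p * p) k Vec.++ replicate (size ps) 0
  spread {ps = p ∷ ps} k (there i) = replicate (p * p) 0 Vec.++ spread k i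

  sum-replicate : ∀ m k → Vec.sum (replicate m k) ≡ m * k
  sum-replicate zero    k = refl
  sum-replicate (suc m) k = cong (k +_) (sum-replicate m k)

  sum-spread : ∀ {p ps} k (i : p ∈ ps) → Vec.sum (spread k i) ≡ p * p * k
  sum-spread {ps = p ∷ ps} k (here refl) =
    trans (Vec.sum-++ (replicate (p * p) k))
      (trans (cong₂ _+_ (sum-replicate (p * p) k) (trans (sum-replicate (size ps) 0) (*-zeroʳ (size ps)))) (+-identityʳ _))
  sum-spread {ps = p ∷ ps} k (there i) =
    trans (Vec.sum-++ (replicate (p * p) 0))
      (cong₂ _+_ (trans (sum-replicate (p * p) 0) (*-zeroʳ (p * p))) (sum-spread k i))

  zero-loads : ∀ {m} (P : Vec ℕ m) → loads (replicate m 0) P ≡ List.replicate m 0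
  zero-loads []      = refl
  zero-loads (x ∷ P) = cong (0 ∷_) (zero-loads P)

  constant-loads : ∀ m k p → loads (replicate m k) (replicate m p) ≡ List.replicate m (k * p)
  constant-loads m k p = trans (cong toList (Vec.zipWith-replicate {n = m} _*_ k p)) (Vec.toList-replicate m (k * p))

  sum-replicateˡ : ∀ m k → sum (List.replicate m k) ≡ m * k
  sum-replicateˡ zero    k = refl
  sum-replicateˡ (suc m) k = cong (k +_) (sum-replicateˡ m k)

  loads-spread-here : ∀ p ps k → loads (spread {p} {p ∷ ps} k (here refl)) (machines (p ∷ ps)) ≡
                      List.replicate (p * p) (k * p) List.++ List.replicate (size ps) 0
  loads-spread-here p ps k = trans (loads-++ (replicate (p * p) k) _ (replicate (size ps) 0) _)
    (cong₂ List._++_ (constant-loads (p * p) k p) (zero-loads (machines ps)))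

  loads-spread-there : ∀ {p} p′ ps k (i : p ∈ ps) → loads (spread {ps = p′ ∷ ps} k (there i)) (machines (p′ ∷ ps)) ≡
                       List.replicate (p′ * p′) 0 List.++ loads (spread k i) (machines ps)
  loads-spread-there p′ ps k i = trans (loads-++ (replicate (p′ * p′) 0) _ (spread k i) _)
    (cong (List._++ _) (zero-loads (replicate (p′ * p′) p′)))

  sum-loads-spread : ∀ {p ps} k (i : p ∈ ps) → sum (loads (spread k i) (machines ps)) ≡ p * p * (k * p)
  sum-loads-spread {ps = p ∷ ps} k (here refl) =
    trans (cong sum (loads-spread-here p ps k)) (trans (sum-++ (List.replicate (p * p) (k * p)) _)
      (trans (cong₂ _+_ (sum-replicateˡ (p * p) (k * p)) (trans (sum-replicateˡ (size ps) 0) (*-zeroʳ (size ps))))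
        (+-identityʳ _)))
  sum-loads-spread {ps = p ∷ ps} k (there i) =
    trans (cong sum (loads-spread-there p ps k i)) (trans (sum-++ (List.replicate (p * p) 0) _)
      (cong₂ _+_ (trans (sum-replicateˡ (p * p) 0) (*-zeroʳ (p * p))) (sum-loads-spread k i)))

  loads-spread-≤ : ∀ {p ps} k (i : p ∈ ps) → All (_≤ k * p) (loads (spread k i) (machines ps))
  loads-spread-≤ {ps = p ∷ ps} k (here refl) = subst (All _) (sym (loads-spread-here p ps k))
    (All.++⁺ (All.replicate⁺ (p * p) ≤-refl) (All.replicate⁺ (size ps) z≤n))
  loads-spread-≤ {ps = p ∷ ps} k (there i) = subst (All _) (sym (loads-spread-there p ps k i))
    (All.++⁺ (All.replicate⁺ (p * p) z≤n) (loads-spread-≤ k i))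

  -- Sums of the largest loads.

  sum-take-≤ : ∀ k xs → sum (take k xs) ≤ sum xs
  sum-take-≤ zero    xs       = z≤n
  sum-take-≤ (suc k) []       = z≤n
  sum-take-≤ (suc k) (x ∷ xs) = +-monoʳ-≤ x (sum-take-≤ k xs)

  sum-take-≤-* : ∀ {M} k {xs} → All (_≤ M) xs → sum (take k xs) ≤ k * M
  sum-take-≤-* zero    _            = z≤n
  sum-take-≤-* (suc k) []           = z≤n
  sum-take-≤-* (suc k) (x≤M ∷ xs≤M) = +-mono-≤ x≤M (sum-take-≤-* k xs≤M)

  -- Take for `t` the smallest of the first `suc k` entries: each of these is `t` plus its excess,
  -- and all later entries have excess 0.
  take-threshold : ∀ k {xs} → AllPairs _≥_ xs → suc k ≤ length xs →
    ∃[ t ] t ∈ xs × sum (map (_∸ t) xs) + suc k * t ≤ sum (take (suc k) xs)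
  take-threshold zero {x ∷ xs} (x≥xs ∷ _) _ = x , here refl , (begin
    sum (map (_∸ x) (x ∷ xs)) + 1 * x
      ≡⟨ cong (_+ 1 * x) (sum-map-zero (_∸ x) {x ∷ xs} (n∸n≡0 x ∷ All.map m≤n⇒m∸n≡0 x≥xs)) ⟩
    x + 0                              ∎)
    where open ≤-Reasoning
  take-threshold (suc k) {x ∷ xs} (x≥xs ∷ sorted) (s≤s k<) with take-threshold k sorted k<
  ... | t , t∈xs , bound = t , there t∈xs , (begin
    (x ∸ t + E) + (t + suc k * t)  ≡⟨ interchange (x ∸ t) E t (suc k * t) ⟩
    (x ∸ t + t) + (E + suc k * t)  ≡⟨ cong (_+ _) (m∸n+n≡m (All.lookup x≥xs t∈xs)) ⟩
    x + (E + suc k * t)            ≤⟨ +-monoʳ-≤ x bound ⟩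
    x + sum (take (suc k) xs)      ∎)
    where
    open ≤-Reasoning
    E = sum (map (_∸ t) xs)

  -- This is `excess-bound` with `r = 1` and `W = t`, added over all groups.
  jobs-bound : ∀ t ps → All (1 ≤_) ps → (s : Vec ℕ (size ps)) →
    Vec.sum s ≤ sum (map (_∸ t) (loads s (machines ps))) + sum ps * t
  jobs-bound t ps 1≤ps s = begin
    Vec.sum s       ≡⟨ *-identityˡ _ ⟨
    1 * Vec.sum s   ≤⟨ groups-bound {1} {h} {_* t} ps (All.map (λ {p} → excess-bound 1 t p) 1≤ps) s ⟩
    sum (map h l) + sum (map (_* t) ps)
      ≡⟨ cong₂ _+_ (cong sum (map-cong (λ y → cong (_∸ t) (*-identityˡ y)) l))
                   (trans (sum-map-*ʳ (λ p → p) t ps) (cong (λ ps → sum ps * t) (map-id ps))) ⟩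
    sum (map (_∸ t) l) + sum ps * t ∎
    where
    open ≤-Reasoning
    l = loads s (machines ps)
    h : ℕ → ℕ
    h y = 1 * y ∸ t

  -- Processing times in geometric progression.

  -- Decreasing order puts the slowest group first, where an induction on `c` can strip it off.
  powers : ℕ → ℕ → List ℕ
  powers q c = map (q ^_) (downFrom (suc c))

  ∈-powers : ∀ q {j c} → j ≤ c → q ^ j ∈ powers q c
  ∈-powers q j≤c = ∈-map⁺ (q ^_) (∈-downFrom⁺ (s≤s j≤c))

  module _ (q : ℕ) (2≤q : 2 ≤ q) where

    private instance
      q≢0 : NonZero q
      q≢0 = >-nonZero (<-trans z<s 2≤q)

    powers-positive : ∀ c → All (1 ≤_) (powers q c)
    powers-positive c = All.map⁺ (All.universal (m^n>0 q) (downFrom (suc c)))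

    sum-powers-< : ∀ c → sum (map (q ^_) (downFrom c)) ≤ q ^ c
    sum-powers-< zero    = z≤n
    sum-powers-< (suc c) = begin
      q ^ c + sum (map (q ^_) (downFrom c)) ≤⟨ +-monoʳ-≤ (q ^ c) (sum-powers-< c) ⟩
      q ^ c + q ^ c                         ≡⟨ cong (q ^ c +_) (+-identityʳ _) ⟨
      2 * q ^ c                             ≤⟨ *-monoˡ-≤ (q ^ c) 2≤q ⟩
      q * q ^ c                             ∎
      where open ≤-Reasoning

    sum-powers : ∀ c → sum (powers q c) ≤ 2 * q ^ c
    sum-powers c = ≤-trans (+-monoʳ-≤ (q ^ c) (sum-powers-< c))
                           (≤-reflexive (cong (q ^ c +_) (sym (+-identityʳ _))))

    -- Groups slower than `q ^ j` contribute 0 and are stripped off; what remains is a geometric sum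
    -- dominated by its largest term.
    sum-below-powers : ∀ j c → sum (map (below (q ^ suc j)) (powers q c)) ≤ 2 * q ^ j
    sum-below-powers j c with c ≤? j
    ... | yes c≤j = begin
      sum (map (below (q ^ suc j)) (powers q c)) ≤⟨ sum-map-mono (below-≤ (q ^ suc j)) (powers q c) ⟩
      sum (map (λ p → p) (powers q c))           ≡⟨ cong sum (map-id (powers q c)) ⟩
      sum (powers q c)                           ≤⟨ sum-powers c ⟩
      2 * q ^ c                                  ≤⟨ *-monoʳ-≤ 2 (^-monoʳ-≤ q c≤j) ⟩
      2 * q ^ j                                  ∎
      where open ≤-Reasoning
    sum-below-powers j zero    | no c≰j = contradiction z≤n c≰j
    sum-below-powers j (suc c) | no c≰j with q ^ suc c <? q ^ suc j
    ... | yes lt = contradiction lt (≤⇒≯ (^-monoʳ-≤ q (≰⇒> c≰j)))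
    ... | no  _  = sum-below-powers j c

    module _ (L : ℕ) where

      private
        Q = q ^ L
        ps = powers q L

      -- With K = suc k, the two cases of V ≥ min (n , K Q / 2).
      module _ k (s : Vec ℕ (size ps)) (sum-s : Vec.sum s ≡ Q * Q) {ys}
               (ys↭ : ys ↭ loads s (machines ps)) (sorted : AllPairs _≥_ ys) (k< : suc k ≤ length ys) where

        private
          open ≤-Reasoning
          K = suc k
          V = sum (take K ys)
          threshold = take-threshold k sorted k<
          t = proj₁ threshold
          E = sum (map (_∸ t) ys)
          E+Kt≤V : E + K * t ≤ V
          E+Kt≤V = proj₂ (proj₂ threshold)
          jobs : Q * Q ≤ E + 2 * Q * t
          jobs = begin
            Q * Q            ≡⟨ sum-s ⟨
            Vec.sum s        ≤⟨ jobs-bound t ps (powers-positive L) s ⟩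
            sum (map (_∸ t) (loads s (machines ps))) + sum ps * t
              ≡⟨ cong (_+ sum ps * t) (sum-↭ (Perm.map⁺ (_∸ t) ys↭)) ⟨
            E + sum ps * t   ≤⟨ +-monoʳ-≤ E (*-monoˡ-≤ t (sum-powers L)) ⟩
            E + 2 * Q * t    ∎

        top-bound-large : 2 * Q ≤ K → Q * Q ≤ V
        top-bound-large 2Q≤K = ≤-trans jobs (≤-trans (+-monoʳ-≤ E (*-monoˡ-≤ t 2Q≤K)) E+Kt≤V)

        top-bound-small : K ≤ 2 * Q → K * Q ≤ 2 * V
        -- After multiplication by `Q`, the bound `K ≤ 2 * Q` gives the excess term the factor
        -- `2 * Q` that the threshold term already carries, so `E + K * t` can be factored out.
        top-bound-small K≤2Q = *-cancelˡ-≤ Q {{m^n≢0 q L}} (begin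
          Q * (K * Q)                  ≡⟨ rotate Q K ⟩
          K * (Q * Q)                  ≤⟨ *-monoʳ-≤ K jobs ⟩
          K * (E + 2 * Q * t)          ≡⟨ *-distribˡ-+ K E _ ⟩
          K * E + K * (2 * Q * t)      ≤⟨ +-monoˡ-≤ _ (*-monoˡ-≤ E K≤2Q) ⟩
          2 * Q * E + K * (2 * Q * t)  ≡⟨ collect Q E K t ⟩
          Q * (2 * (E + K * t))        ≤⟨ *-monoʳ-≤ Q (*-monoʳ-≤ 2 E+Kt≤V) ⟩
          Q * (2 * V)                  ∎)
          where
          rotate : ∀ a b → a * (b * a) ≡ b * (a * a)
          rotate = solve-∀
          collect : ∀ Q E K t → 2 * Q * E + K * (2 * Q * t) ≡ Q * (2 * (E + K * t))
          collect = solve-∀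

      -- Cut the groups at `r = q ^ suc j`. The small total load leaves few jobs at or above the
      -- cut, the small maximum load few below it; together they must still process all `n` jobs.
      -- The total accounts for `2 * a` and the fast groups for `4 * a`.
      unbalanced : ∀ {j j′ a n} (s : Vec ℕ (size ps)) → Vec.sum s ≡ n → 1 ≤ n → j < j′ →
        sum (loads s (machines ps)) ≤ a * (2 * (n * q ^ j)) →
        All (λ y → q ^ j′ * y ≤ a * (2 * n)) (loads s (machines ps)) →
        q ≤ 6 * a
      unbalanced {j} {j′} {a} {n} s sum-s 1≤n j<j′ total light = *-cancelˡ-≤ (q ^ j * n) (begin
        q ^ j * n * q                ≡⟨ rotate (q ^ j) n q ⟩
        q ^ suc j * n                ≡⟨ cong (q ^ suc j *_) sum-s ⟨
        q ^ suc j * Vec.sum s        ≤⟨ sum-below-bound (q ^ suc j) W ps (powers-positive L) s light′ ⟩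
        sum l + sum (map (below (q ^ suc j)) ps) * W
                                     ≤⟨ +-mono-≤ total (*-monoˡ-≤ W (sum-below-powers j L)) ⟩
        a * (2 * (n * q ^ j)) + 2 * q ^ j * W
                                     ≡⟨ collect a n (q ^ j) ⟩
        q ^ j * n * (6 * a)          ∎)
        where
        open ≤-Reasoning
        instance
          qʲn≢0 : NonZero (q ^ j * n)
          qʲn≢0 = m*n≢0 (q ^ j) n {{m^n≢0 q j}} {{>-nonZero 1≤n}}
        W = a * (2 * n)
        l = loads s (machines ps)
        light′ : All (λ y → q ^ suc j * y ≤ W) l
        light′ = All.map (λ {y} → ≤-trans (*-monoˡ-≤ y (^-monoʳ-≤ q j<j′))) light
        rotate : ∀ x n q → x * n * q ≡ q * x * n
        rotate = solve-∀
        collect : ∀ a n x → a * (2 * (n * x)) + 2 * x * (a * (2 * n)) ≡ x * n * (6 * a)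
        collect = solve-∀

  -- The ordered norms that separate the groups.

  weight : ℕ → ∀ d → Vec ℕ d
  weight N zero    = []
  weight N (suc d) = N ∷ replicate d 1

  -- On a decreasing list of loads this is the ordered norm with weight `(N , 1 , … , 1)`.
  weighted : ℕ → List ℕ → ℕ
  weighted N []       = 0
  weighted N (y ∷ ys) = N * y + sum ys

  zipWith-ones : ∀ ys → List.zipWith _*_ (toList (replicate (length ys) 1)) ys ≡ ys
  zipWith-ones []       = refl
  zipWith-ones (y ∷ ys) = cong₂ _∷_ (*-identityˡ y) (zipWith-ones ys)

  sum-zipWith-weight : ∀ N ys → sum (List.zipWith _*_ (toList (weight N (length ys))) ys) ≡ weighted N ys
  sum-zipWith-weight N []       = refl
  sum-zipWith-weight N (y ∷ ys) = cong (λ l → N * y + sum l) (zipWith-ones ys)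

  sum≤weighted : ∀ {N} → 1 ≤ N → ∀ ys → sum ys ≤ weighted N ys
  sum≤weighted     1≤N []       = z≤n
  sum≤weighted {N} 1≤N (y ∷ ys) = +-monoˡ-≤ (sum ys) (m≤n*m y N {{>-nonZero 1≤N}})

  max≤weighted : ∀ {N ys} → AllPairs _≥_ ys → All (λ y → N * y ≤ weighted N ys) ys
  max≤weighted         []         = []
  max≤weighted {N} {y ∷ ys} (y≥ys ∷ _) =
    m≤m+n (N * y) _ ∷ All.map (λ z≤y → ≤-trans (*-monoʳ-≤ N z≤y) (m≤m+n (N * y) _)) y≥ys

  weighted≤ : ∀ {N M ys} → All (_≤ M) ys → weighted N ys ≤ N * M + sum ys
  weighted≤ []                               = z≤n
  weighted≤ {N} {ys = y ∷ ys} (y≤M ∷ _) = +-mono-≤ (*-monoʳ-≤ N y≤M) (m≤n+m (sum ys) y)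

  -- All `p * p` busy machines have load `k * p`, so with first weight `p * p` the maximum term
  -- equals the total load, whence the factor 2.
  weighted-spread : ∀ {p ps k ys} (i : p ∈ ps) → ys ↭ loads (spread k i) (machines ps) →
    weighted (p * p) ys ≤ 2 * (p * p * k * p)
  weighted-spread {p} {ps} {k} {ys} i ys↭ = begin
    weighted (p * p) ys           ≤⟨ weighted≤ {p * p} (Perm.All-resp-↭ (↭-sym ys↭) (loads-spread-≤ k i)) ⟩
    p * p * (k * p) + sum ys      ≡⟨ cong (p * p * (k * p) +_) (trans (sum-↭ ys↭) (sum-loads-spread k i)) ⟩
    p * p * (k * p) + p * p * (k * p) ≡⟨ double p k ⟩
    2 * (p * p * k * p)           ∎
    where
    open ≤-Reasoning
    double : ∀ p k → p * p * (k * p) + p * p * (k * p) ≡ 2 * (p * p * k * p)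
    double = solve-∀

  weighted-light : ∀ {p n a ys} → 1 ≤ p → AllPairs _≥_ ys → weighted (p * p) ys ≤ a * (2 * (n * p)) →
    All (λ y → p * y ≤ a * (2 * n)) ys
  weighted-light {p} {n} {a} {ys} 1≤p sorted good = All.map light (max≤weighted {p * p} sorted)
    where
    open ≤-Reasoning
    pull : ∀ p n a → a * (2 * (n * p)) ≡ p * (a * (2 * n))
    pull = solve-∀
    light : ∀ {y} → p * p * y ≤ weighted (p * p) ys → p * y ≤ a * (2 * n)
    light {y} py≤ = *-cancelˡ-≤ p {{>-nonZero 1≤p}} (begin
      p * (p * y)          ≡⟨ *-assoc p p y ⟨
      p * p * y            ≤⟨ py≤ ⟩
      weighted (p * p) ys  ≤⟨ good ⟩
      a * (2 * (n * p))    ≡⟨ pull p n a ⟩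
      p * (a * (2 * n))    ∎)

  machines-positive : ∀ {ps} → All (1 ≤_) ps → VecAll.All (1 ≤_) (machines ps)
  machines-positive []             = VecAll.[]
  machines-positive {p ∷ ps} (1≤p ∷ 1≤ps) = VecAll.++⁺ (constant (p * p)) (machines-positive 1≤ps)
    where
    constant : ∀ m → VecAll.All (1 ≤_) (replicate m p)
    constant zero    = VecAll.[]
    constant (suc m) = 1≤p VecAll.∷ constant m

  weight-decreasing : ∀ {N} → 1 ≤ N → ∀ {d} {i j : Fin d} → i Fin.≤ j →
                      lookup (weight N d) j ≤ lookup (weight N d) i
  weight-decreasing 1≤N {suc d} {zero}  {zero}  _ = ≤-refl
  weight-decreasing 1≤N {suc d} {zero}  {suc j} _ = ≤-trans (≤-reflexive (Vec.lookup-replicate j 1)) 1≤N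
  weight-decreasing 1≤N {suc d} {suc i} {suc j} _ =
    ≤-reflexive (trans (Vec.lookup-replicate j 1) (sym (Vec.lookup-replicate i 1)))

  -- The number of machines and its logarithms.

  n<2^n : ∀ n → n < 2 ^ n
  n<2^n zero    = z<s
  n<2^n (suc n) = begin-strict
    suc n           <⟨ s<s (n<2^n n) ⟩
    1 + 2 ^ n       ≤⟨ +-monoˡ-≤ (2 ^ n) (m^n>0 2 n) ⟩
    2 ^ n + 2 ^ n   ≡⟨ cong (2 ^ n +_) (+-identityʳ _) ⟨
    2 * 2 ^ n       ∎
    where open ≤-Reasoning

  size-powers-< : ∀ {q} → 2 ≤ q → ∀ c → size (map (q ^_) (downFrom c)) ≤ q ^ c * q ^ c
  size-powers-< 2≤q zero    = z≤n
  size-powers-< {q} 2≤q (suc c) = begin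
    q ^ c * q ^ c + size (map (q ^_) (downFrom c))  ≤⟨ +-monoʳ-≤ (q ^ c * q ^ c) (size-powers-< 2≤q c) ⟩
    q ^ c * q ^ c + q ^ c * q ^ c                   ≡⟨ double (q ^ c) ⟩
    2 * q ^ c * (1 * q ^ c)                         ≤⟨ *-mono-≤ (*-monoˡ-≤ (q ^ c) 2≤q) (*-monoˡ-≤ (q ^ c) (≤-trans (n≤1+n 1) 2≤q)) ⟩
    q * q ^ c * (q * q ^ c)                         ∎
    where
    open ≤-Reasoning
    double : ∀ x → x * x + x * x ≡ 2 * x * (1 * x)
    double = solve-∀

  size-powers : ∀ {q} → 2 ≤ q → ∀ c → size (powers q c) ≤ 2 * (q ^ c * q ^ c)
  size-powers {q} 2≤q c = ≤-trans (+-monoʳ-≤ (q ^ c * q ^ c) (size-powers-< 2≤q c))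
                                  (≤-reflexive (cong (q ^ c * q ^ c +_) (sym (+-identityʳ _))))

  module _ (m : ℕ) where

    private
      k = suc m
      q = 2 ^ k
      d = size (powers q q)
      e = k * q + k * q

      Q*Q≡2^e : q ^ q * q ^ q ≡ 2 ^ e
      Q*Q≡2^e = trans (cong (λ x → x * x) (^-*-assoc 2 k q)) (sym (^-distribˡ-+-* 2 (k * q) (k * q)))

      2^e≤d : 2 ^ e ≤ d
      2^e≤d = ≤-trans (≤-reflexive (sym Q*Q≡2^e)) (m≤m+n (q ^ q * q ^ q) _)

      q≤e : q ≤ e
      q≤e = ≤-trans (m≤n*m q k) (m≤m+n (k * q) _)

    2≤2^suc : 2 ≤ 2 ^ suc m
    2≤2^suc = *-monoʳ-≤ 2 (m^n>0 2 m)

    m<2^suc : m < 2 ^ suc m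
    m<2^suc = <-≤-trans (n<2^n m) (^-monoʳ-≤ 2 (n≤1+n m))

    m≤size : m ≤ size (powers (2 ^ suc m) (2 ^ suc m))
    m≤size = ≤-trans (<⇒≤ m<2^suc) (≤-trans q≤e (≤-trans (<⇒≤ (n<2^n e)) 2^e≤d))

    -- With `q = 2 ^ k` and `e = 2 k q`, `d` lies between `2 ^ e` and `2 ^ suc e`. Hence `log d` is
    -- at most `suc e`, while `log log d` is at least `log q = k`.
    log-size : ∀ {l} → suc (2 ^ suc m) ≤ l → let d = size (powers (2 ^ suc m) (2 ^ suc m)) in
               ⌈log₂ d ⌉ ≤ 2 * (l * ⌊log₂ ⌊log₂ d ⌋ ⌋)
    log-size {l} q<l = begin
      ⌈log₂ d ⌉            ≤⟨ ⌈log₂⌉-mono-≤ (≤-trans (size-powers 2≤2^suc q) (≤-reflexive (cong (2 *_) Q*Q≡2^e))) ⟩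
      ⌈log₂ 2 ^ suc e ⌉    ≡⟨ ⌈log₂2^n⌉≡n (suc e) ⟩
      -- Enlarging 1 to `k + k` completes the expression to a multiple of `suc q`, the number of
      -- groups.
      suc e                ≤⟨ s≤s (m≤n+m e (m + suc m)) ⟩
      k + k + e            ≡⟨ collect k q ⟩
      2 * (suc q * k)      ≤⟨ *-monoʳ-≤ 2 (*-mono-≤ q<l k≤) ⟩
      2 * (l * ⌊log₂ ⌊log₂ d ⌋ ⌋) ∎
      where
      open ≤-Reasoning
      collect : ∀ k q → k + k + (k * q + k * q) ≡ 2 * (suc q * k)
      collect = solve-∀
      k≤ : k ≤ ⌊log₂ ⌊log₂ d ⌋ ⌋
      k≤ = begin
        k                          ≡⟨ ⌊log₂[2^n]⌋≡n k ⟨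
        ⌊log₂ 2 ^ k ⌋              ≤⟨ ⌊log₂⌋-mono-≤ q≤e ⟩
        ⌊log₂ e ⌋                  ≡⟨ cong ⌊log₂_⌋ (⌊log₂[2^n]⌋≡n e) ⟨
        ⌊log₂ ⌊log₂ 2 ^ e ⌋ ⌋      ≤⟨ ⌊log₂⌋-mono-≤ (⌊log₂⌋-mono-≤ 2^e≤d) ⟩
        ⌊log₂ ⌊log₂ d ⌋ ⌋          ∎

  -- `N` exceeds each of the finitely many values of `f` below `k`. This turns a threshold on `d`
  -- into one on the index `m`.
  eventually : ∀ (f : ℕ → ℕ) k → ∃[ N ] (∀ m → N ≤ f m → k ≤ m)
  eventually f zero    = 0 , λ _ _ → z≤n
  eventually f (suc k) with eventually f k
  ... | N , large = N ⊔ suc (f k) , λ m N≤fm → ≤∧≢⇒<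
    (large m (≤-trans (m≤m⊔n N _) N≤fm))
    (λ { refl → <-irrefl refl (≤-trans (m≤n⊔m N _) N≤fm) })

open Combinatorics

-- Transfer between natural numbers and the ordered field.

module Field {a ℓ} (R : ArchimedeanOrderedField a ℓ) where

  open ArchimedeanOrderedField R
  open MLIJ R

  module Order = DecTotalOrder decTotalOrder
  module Ring = CommutativeRing commutativeRing

  open import Algebra.Properties.Monoid.Mult Ring.+-monoid using (×-homo-+; ×-assocˡ)
  open import Algebra.Properties.Semiring.Mult Ring.semiring using (×1-homo-*)
  open import Algebra.Properties.Ring Ring.ring using (-1*x≈-x; -‿involutive)
  open import Algebra.Construct.NaturalChoice.Max Order.totalOrder using (x≤y⇒y⊔x≈y)
  open import Data.List.Extrema Order.totalOrder using (argmin; f[argmin]≤f[xs]; argmin-all)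
  open import Relation.Binary.Reasoning.PartialOrder Order.poset

  +-monoˡ-≤ : ∀ z {x y} → x ≤ y → x + z ≤ y + z
  +-monoˡ-≤ z {x} {y} x≤y = subst₂ _≤_ (Ring.+-comm z x) (Ring.+-comm z y) (+-monoʳ-≤ z x≤y)

  x≤0⇒0≤-x : ∀ {x} → x ≤ 0# → 0# ≤ - x
  x≤0⇒0≤-x {x} x≤0 = subst₂ _≤_ (Ring.-‿inverseˡ x) (Ring.+-identityʳ (- x)) (+-monoʳ-≤ (- x) x≤0)

  0≤x⇒-x≤0 : ∀ {x} → 0# ≤ x → - x ≤ 0#
  0≤x⇒-x≤0 {x} 0≤x = subst₂ _≤_ (Ring.+-identityʳ (- x)) (Ring.-‿inverseˡ x) (+-monoʳ-≤ (- x) 0≤x)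

  0≤1 : 0# ≤ 1#
  0≤1 with Order.total 0# 1#
  ... | inj₁ 0≤1 = 0≤1
  ... | inj₂ 1≤0 = subst (0# ≤_) (trans (-1*x≈-x (- 1#)) (-‿involutive 1#))
                     (*-nonNegative (x≤0⇒0≤-x 1≤0) (x≤0⇒0≤-x 1≤0))

  *-monoˡ-≤ : ∀ {z x y} → 0# ≤ z → x ≤ y → z * x ≤ z * y
  *-monoˡ-≤ {z} {x} {y} 0≤z x≤y = begin
    z * x                    ≡⟨ Ring.+-identityˡ (z * x) ⟨
    0# + z * x               ≤⟨ +-monoˡ-≤ (z * x) (*-nonNegative 0≤z 0≤y-x) ⟩
    z * (y + - x) + z * x    ≡⟨ Ring.distribˡ z (y + - x) x ⟨
    z * (y + - x + x)        ≡⟨ cong (z *_) (trans (Ring.+-assoc y (- x) x) (trans (cong (y +_) (Ring.-‿inverseˡ x)) (Ring.+-identityʳ y))) ⟩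
    z * y                    ∎
    where
    0≤y-x : 0# ≤ y + - x
    0≤y-x = subst (_≤ y + - x) (Ring.-‿inverseʳ x) (+-monoˡ-≤ (- x) x≤y)

  *-monoʳ-≤ : ∀ {z x y} → 0# ≤ z → x ≤ y → x * z ≤ y * z
  *-monoʳ-≤ {z} {x} {y} 0≤z x≤y = subst₂ _≤_ (Ring.*-comm z x) (Ring.*-comm z y) (*-monoˡ-≤ 0≤z x≤y)

  fromℕ-+ : ∀ m n → fromℕ (m ℕ.+ n) ≡ fromℕ m + fromℕ n
  fromℕ-+ = ×-homo-+ 1#

  fromℕ-* : ∀ m n → fromℕ (m ℕ.* n) ≡ fromℕ m * fromℕ n
  fromℕ-* = ×1-homo-*

  0≤fromℕ : ∀ n → 0# ≤ fromℕ n
  0≤fromℕ zero    = Order.refl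
  0≤fromℕ (suc n) = begin
    0#             ≤⟨ 0≤1 ⟩
    1#             ≡⟨ Ring.+-identityʳ 1# ⟨
    1# + 0#        ≤⟨ +-monoʳ-≤ 1# (0≤fromℕ n) ⟩
    1# + fromℕ n   ∎

  fromℕ-mono-≤ : ∀ {m n} → m ℕ.≤ n → fromℕ m ≤ fromℕ n
  fromℕ-mono-≤ {n = n} ℕ.z≤n     = 0≤fromℕ n
  fromℕ-mono-≤ (ℕ.s≤s m≤n) = +-monoʳ-≤ 1# (fromℕ-mono-≤ m≤n)

  -- Otherwise `suc n ≤ m`, so `1# + fromℕ n ≤ fromℕ n` and `1# ≤ 0#`. Field inequalities between
  -- norms thereby return to the natural numbers.
  fromℕ-cancel-≤ : ∀ {m n} → fromℕ m ≤ fromℕ n → m ℕ.≤ n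
  fromℕ-cancel-≤ {m} {n} fm≤fn with m ℕ.≤? n
  ... | yes m≤n = m≤n
  ... | no  m≰n = contradiction (Order.antisym 0≤1 1≤0) 0≢1
    where
    1≤0 : 1# ≤ 0#
    1≤0 = begin
      1#                         ≡⟨ Ring.+-identityʳ 1# ⟨
      1# + 0#                    ≡⟨ cong (1# +_) (Ring.-‿inverseʳ (fromℕ n)) ⟨
      1# + (fromℕ n + - fromℕ n) ≡⟨ Ring.+-assoc 1# (fromℕ n) (- fromℕ n) ⟨
      fromℕ (suc n) + - fromℕ n  ≤⟨ +-monoˡ-≤ (- fromℕ n) (Order.trans (fromℕ-mono-≤ (ℕ.≰⇒> m≰n)) fm≤fn) ⟩
      fromℕ n + - fromℕ n        ≡⟨ Ring.-‿inverseʳ (fromℕ n) ⟩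
      0#                         ∎

  fromℕ-injective : ∀ {m n} → fromℕ m ≡ fromℕ n → m ≡ n
  fromℕ-injective eq = ℕ.≤-antisym (fromℕ-cancel-≤ (Order.reflexive eq))
                                   (fromℕ-cancel-≤ (Order.reflexive (sym eq)))

  0<fromℕ : ∀ {n} → 1 ℕ.≤ n → 0# < fromℕ n
  0<fromℕ {n} 1≤n = 0≤fromℕ n , λ 0≡fn → ℕ.<⇒≢ 1≤n (fromℕ-injective 0≡fn)

  weight-isWeight : ∀ {N d} → 1 ℕ.≤ N → 1 ℕ.≤ d → IsWeight (Vec.map fromℕ (weight N d))
  weight-isWeight {N} {d} 1≤N 1≤d = record
    { nonzero     = nonzero 1≤d
    ; decreasing  = λ {i} {j} i≤j → subst₂ _≤_ (sym (Vec.lookup-map j fromℕ (weight N d)))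
                      (sym (Vec.lookup-map i fromℕ (weight N d))) (fromℕ-mono-≤ (weight-decreasing 1≤N i≤j))
    ; nonNegative = λ i → subst (0# ≤_) (sym (Vec.lookup-map i fromℕ (weight N d))) (0≤fromℕ (lookup (weight N d) i))
    }
    where
    nonzero : ∀ {d} → 1 ℕ.≤ d → Vec.map fromℕ (weight N d) ≢ replicate d 0#
    nonzero (ℕ.s≤s _) eq = proj₂ (0<fromℕ 1≤N) (sym (cong Vec.head eq))

  ∣fromℕ∣ : ∀ n → ∣ fromℕ n ∣ ≡ fromℕ n
  ∣fromℕ∣ n = x≤y⇒y⊔x≈y (Order.trans (0≤x⇒-x≤0 (0≤fromℕ n)) (0≤fromℕ n))

  sum-fromℕ : ∀ xs → sum (map fromℕ xs) ≡ fromℕ (ℕ.sum xs)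
  sum-fromℕ []       = refl
  sum-fromℕ (x ∷ xs) = trans (cong (fromℕ x +_) (sum-fromℕ xs)) (sym (fromℕ-+ x _))

  zipWith-*-fromℕ : ∀ xs ys → List.zipWith _*_ (map fromℕ xs) (map fromℕ ys) ≡
                              map fromℕ (List.zipWith ℕ._*_ xs ys)
  zipWith-*-fromℕ []       ys       = refl
  zipWith-*-fromℕ (x ∷ xs) []       = refl
  zipWith-*-fromℕ (x ∷ xs) (y ∷ ys) = cong₂ _∷_ (sym (fromℕ-* x y)) (zipWith-*-fromℕ xs ys)

  toList-loadVector : ∀ {d} (s P : Vec ℕ d) →
                      toList (loadVector s (Vec.map fromℕ P)) ≡ map fromℕ (loads s P)
  toList-loadVector []      []      = refl
  toList-loadVector (n ∷ s) (p ∷ P) = cong₂ _∷_ (×-assocˡ 1# n p) (toList-loadVector s P)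

  loads-injective : ∀ {d} (s s′ P : Vec ℕ d) →
    loadVector s (Vec.map fromℕ P) ≡ loadVector s′ (Vec.map fromℕ P) → loads s P ≡ loads s′ P
  loads-injective s s′ P eq = map-injective fromℕ-injective
    (trans (sym (toList-loadVector s P)) (trans (cong toList eq) (toList-loadVector s′ P)))

  module _ {d} (s P : Vec ℕ d) where

    private
      x : Vec Carrier d
      x = loadVector s (Vec.map fromℕ P)

    -- Since all loads are images of natural numbers, the sorted vector is the image of a natural
    -- list `ys`, and both kinds of norm can be computed on `ys`.
    record SortedLoads : Set a where
      field
        ys      : List ℕ
        perm    : ys ↭ loads s P
        sorted  : AllPairs ℕ._≥_ ys
        ∣x∣↓≡   : ∣ x ∣↓ ≡ map fromℕ ys

      length-ys : length ys ≡ d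
      length-ys = trans (Perm.↭-length perm) (Vec.length-toList (zipWith ℕ._*_ s P))

      topNorm≡ : ∀ k → topNorm k x ≡ fromℕ (ℕ.sum (take k ys))
      topNorm≡ k = trans (cong (sum ∘ take k) ∣x∣↓≡) (trans (cong sum (take-map k ys)) (sum-fromℕ (take k ys)))

      orderedNorm≡ : ∀ N → orderedNorm (Vec.map fromℕ (weight N d)) x ≡ fromℕ (weighted N ys)
      orderedNorm≡ N = begin-equality
        sum (List.zipWith _*_ (toList (Vec.map fromℕ (weight N d))) ∣ x ∣↓)
          ≡⟨ cong₂ (λ u v → sum (List.zipWith _*_ u v)) (Vec.toList-map fromℕ (weight N d)) ∣x∣↓≡ ⟩
        sum (List.zipWith _*_ (map fromℕ (toList (weight N d))) (map fromℕ ys))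
          ≡⟨ cong sum (zipWith-*-fromℕ (toList (weight N d)) ys) ⟩
        sum (map fromℕ (List.zipWith ℕ._*_ (toList (weight N d)) ys))
          ≡⟨ sum-fromℕ (List.zipWith ℕ._*_ (toList (weight N d)) ys) ⟩
        fromℕ (ℕ.sum (List.zipWith ℕ._*_ (toList (weight N d)) ys))
          ≡⟨ cong (λ d → fromℕ (ℕ.sum (List.zipWith ℕ._*_ (toList (weight N d)) ys))) length-ys ⟨
        fromℕ (ℕ.sum (List.zipWith ℕ._*_ (toList (weight N (length ys))) ys))
          ≡⟨ cong fromℕ (sum-zipWith-weight N ys) ⟩
        fromℕ (weighted N ys) ∎

    open Sort (Flip.decTotalOrder decTotalOrder) using (sort-↭; sort-↗)

    sortedLoads : SortedLoads
    -- Sorting takes place in the field; a permutation of a list of images is itself a list of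
    -- images, which recovers `ys`.
    sortedLoads with Perm.↭-map-inv fromℕ (subst (_↭ ∣ x ∣↓) absolute (↭-sym (sort-↭ (map ∣_∣ (toList x)))))
      where
      absolute : map ∣_∣ (toList x) ≡ map fromℕ (loads s P)
      absolute = trans (cong (map ∣_∣) (toList-loadVector s P)) (go (loads s P))
        where
        go : ∀ xs → map ∣_∣ (map fromℕ xs) ≡ map fromℕ xs
        go []       = refl
        go (x ∷ xs) = cong₂ _∷_ (∣fromℕ∣ x) (go xs)
    ... | ys , eq , perm = record
      { ys     = ys
      ; perm   = ↭-sym perm
      ; sorted = AllPairs.map fromℕ-cancel-≤ (AllPairs.map⁻ (subst (AllPairs _) eq
          (Sorted⇒AllPairs (DecTotalOrder.totalOrder (Flip.decTotalOrder decTotalOrder)) (sort-↗ (map ∣_∣ (toList x))))))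
      ; ∣x∣↓≡  = eq
      }

  topNorm-≤ : ∀ {d} c k {s s′ P : Vec ℕ d} (S : SortedLoads s P) (S′ : SortedLoads s′ P) →
    ℕ.sum (take k (SortedLoads.ys S)) ℕ.≤ c ℕ.* ℕ.sum (take k (SortedLoads.ys S′)) →
    topNorm k (loadVector s (Vec.map fromℕ P)) ≤ fromℕ c * topNorm k (loadVector s′ (Vec.map fromℕ P))
  topNorm-≤ c k S S′ le = begin
    topNorm k _                    ≡⟨ S.topNorm≡ k ⟩
    fromℕ (sumₖ S.ys)              ≤⟨ fromℕ-mono-≤ le ⟩
    fromℕ (c ℕ.* sumₖ S′.ys)       ≡⟨ fromℕ-* c (sumₖ S′.ys) ⟩
    fromℕ c * fromℕ (sumₖ S′.ys)   ≡⟨ cong (fromℕ c *_) (S′.topNorm≡ k) ⟨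
    fromℕ c * topNorm k _          ∎
    where
    module S = SortedLoads S
    module S′ = SortedLoads S′
    sumₖ = λ ys → ℕ.sum (take k ys)

  -- Minima over finite sets and a criterion for portfolios.

  minimum : ∀ {b s} {A : Set b} {S : A → Set s} (f : A → Carrier) (xs : List A) →
            (∀ {x} → x ∈ xs → S x) → (∀ {x} → S x → x ∈ xs) → ∃ S → ∃ (IsMinimum f S)
  -- `x₀` is the default value of `argmin`; taking it from `S` keeps the result in `S`.
  minimum {S = S} f xs sound complete (x₀ , Sx₀) = f x , record
    { attained   = x , argmin-all f {P = S} Sx₀ (All.tabulate sound) , refl
    ; lowerBound = λ Sy → All.lookup (f[argmin]≤f[xs] x₀ xs) (complete Sy)
    }
    where x = argmin f x₀ xs

  -- A finite superset of the schedules: only each entry is bounded by `n`. The filter in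
  -- `feasibles` imposes the exact sum.
  schedules : ∀ d → ℕ → List (Vec ℕ d)
  schedules zero    n = [] ∷ []
  schedules (suc d) n = cartesianProductWith _∷_ (upTo (suc n)) (schedules d n)

  ∈-schedules : ∀ {d n} (s : Vec ℕ d) → Vec.sum s ℕ.≤ n → s ∈ schedules d n
  ∈-schedules []      _   = here refl
  ∈-schedules (x ∷ s) s≤n = ∈-cartesianProductWith⁺ _∷_
    (∈-upTo⁺ (ℕ.s≤s (ℕ.≤-trans (ℕ.m≤m+n x _) s≤n)))
    (∈-schedules s (ℕ.≤-trans (ℕ.m≤n+m _ x) s≤n))

  module _ (I : Instance) where

    open Instance I

    feasibles : List (Vec Carrier d)
    feasibles = map (λ s → loadVector s p) (filter (λ s → Vec.sum s ℕ.≟ n) (schedules d n))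

    ∈-feasibles⁻ : ∀ {x} → x ∈ feasibles → Feasible I x
    ∈-feasibles⁻ x∈ with ∈-map⁻ _ x∈
    ... | s , s∈ , eq = s , proj₂ (∈-filter⁻ (λ s → Vec.sum s ℕ.≟ n) {xs = schedules d n} s∈) , eq

    ∈-feasibles⁺ : ∀ {x} → Feasible I x → x ∈ feasibles
    ∈-feasibles⁺ (s , sum-s , refl) = ∈-map⁺ _
      (∈-filter⁺ (λ s → Vec.sum s ℕ.≟ n) (∈-schedules s (ℕ.≤-reflexive sum-s)) sum-s)

    -- Both minima exist by finiteness, so one member within `α` of every feasible vector suffices
    -- for each function.
    portfolio : ∀ {C α X} → 0# ≤ α → Unique X → (∀ {x} → x ∈ X → Feasible I x) →
      (∀ {f} → C f → ∃[ x ] x ∈ X × (∀ {y} → Feasible I y → f x ≤ α * f y)) →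
      ∃ (Feasible I) → IsPortfolio I C α X
    portfolio {X = X} 0≤α unique feasible good y₀ = record
      { unique      = unique
      ; feasible    = feasible
      ; approximate = λ {f} Cf → approximate f (good Cf)
      }
      where
      approximate : ∀ f → _ → _
      approximate f (x , x∈X , fx≤) with minimum f X (λ x∈ → x∈) (λ x∈ → x∈) (x , x∈X)
                                      | minimum f feasibles ∈-feasibles⁻ ∈-feasibles⁺ y₀
      ... | m , m-min | m* , m*-min with IsMinimum.attained m*-min
      ... | y , y-feasible , refl = m , m* , m-min , m*-min , Order.trans (IsMinimum.lowerBound m-min x∈X) (fx≤ y-feasible)

-- The geometric instance and its portfolio for top-k norms.

module _ {a ℓ} (R : ArchimedeanOrderedField a ℓ) where

  open ArchimedeanOrderedField R
  open MLIJ R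
  open Field R

  module _ (q L : ℕ) (2≤q : 2 ℕ.≤ q) where

    private
      instance
        q≢0 : ℕ.NonZero q
        q≢0 = ℕ.>-nonZero (ℕ.<-trans ℕ.z<s 2≤q)
      ps = powers q L
      P = machines ps
      Q = q ℕ.^ L
      n = Q ℕ.* Q

      1≤Q : 1 ℕ.≤ Q
      1≤Q = ℕ.m^n>0 q L

      1≤n : 1 ℕ.≤ n
      1≤n = ℕ.*-mono-≤ 1≤Q 1≤Q

    -- The number `Q * Q` of jobs is divisible by the number of machines in every group, so even
    -- spreading is exact.
    geometric : Instance
    geometric = record
      { n   = n
      ; n≥1 = 1≤n
      ; d   = size ps
      ; p   = Vec.map fromℕ P
      ; p>0 = λ i → subst (0# <_) (sym (Vec.lookup-map i fromℕ P))
                (0<fromℕ (VecAll.lookup (machines-positive (powers-positive q 2≤q L)) (∈-lookup i P)))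
      }

    module _ {j} (j≤L : j ℕ.≤ L) where

      private
        p = q ℕ.^ j
        k = q ℕ.^ (L ℕ.∸ j) ℕ.* q ℕ.^ (L ℕ.∸ j)

      balanced : Vec ℕ (size ps)
      balanced = spread k (∈-powers q j≤L)

      private
        p*p*k≡n : p ℕ.* p ℕ.* k ≡ n
        p*p*k≡n = trans (*-interchange p p (q ℕ.^ (L ℕ.∸ j)) _)
          (cong (λ x → x ℕ.* x) (trans (sym (ℕ.^-distribˡ-+-* q j (L ℕ.∸ j))) (cong (q ℕ.^_) (ℕ.m+[n∸m]≡n j≤L))))

      balanced-feasible : Feasible geometric (loadVector balanced (Vec.map fromℕ P))
      balanced-feasible = balanced , trans (sum-spread k (∈-powers q j≤L)) p*p*k≡n , refl

      sum-balanced : ℕ.sum (loads balanced P) ≡ n ℕ.* q ℕ.^ j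
      sum-balanced = trans (sum-loads-spread k (∈-powers q j≤L))
        (trans (sym (ℕ.*-assoc (p ℕ.* p) k _)) (cong (ℕ._* p) p*p*k≡n))

      balanced-≤ : All (ℕ._≤ k ℕ.* p) (loads balanced P)
      balanced-≤ = loads-spread-≤ k (∈-powers q j≤L)

      weighted-balanced : ∀ {ys} → ys ↭ loads balanced P →
                          weighted (p ℕ.* p) ys ℕ.≤ 2 ℕ.* (n ℕ.* p)
      weighted-balanced ys↭ = ℕ.≤-trans (weighted-spread (∈-powers q j≤L) ys↭)
        (ℕ.≤-reflexive (cong (λ n → 2 ℕ.* (n ℕ.* p)) p*p*k≡n))

    private
      -- Group 0 is a single machine, so `fast` puts all jobs on it; `slow` puts one job on each of
      -- the `n` slowest machines.
      fast slow : Vec ℕ (size ps)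
      fast = balanced {0} ℕ.z≤n
      slow = balanced {L} ℕ.≤-refl

      slow-≤ : All (ℕ._≤ Q) (loads slow P)
      slow-≤ = All.map (λ y≤ → ℕ.≤-trans y≤ (ℕ.≤-reflexive
        (trans (cong (λ e → q ℕ.^ e ℕ.* q ℕ.^ e ℕ.* Q) (ℕ.n∸n≡0 L)) (ℕ.+-identityʳ Q)))) (balanced-≤ ℕ.≤-refl)

      vector : Vec ℕ (size ps) → Vec Carrier (size ps)
      vector s = loadVector s (Vec.map fromℕ P)

    topPortfolio : 1 ℕ.≤ L → IsPortfolio geometric (TopKNorms (size ps)) (fromℕ 2) (vector fast ∷ vector slow ∷ [])
    topPortfolio 1≤L = portfolio geometric (0≤fromℕ 2)
      ((fast≢slow ∷ []) ∷ [] ∷ [])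
      (λ { (here refl) → balanced-feasible ℕ.z≤n ; (there (here refl)) → balanced-feasible ℕ.≤-refl })
      good (_ , balanced-feasible {0} ℕ.z≤n)
      where
      fast≢slow : vector fast ≢ vector slow
      -- The total loads are `n` and `n * Q`, and `1 ≤ L` makes `Q` exceed 1.
      fast≢slow eq = ℕ.<-irrefl q⁰≡qᴸ (ℕ.^-monoʳ-< q 2≤q 1≤L)
        where
        q⁰≡qᴸ : q ℕ.^ 0 ≡ q ℕ.^ L
        q⁰≡qᴸ = ℕ.*-cancelˡ-≡ (q ℕ.^ 0) Q n {{ℕ.>-nonZero 1≤n}} (begin
          n ℕ.* q ℕ.^ 0          ≡⟨ sum-balanced ℕ.z≤n ⟨
          ℕ.sum (loads fast P)   ≡⟨ cong ℕ.sum (loads-injective fast slow P eq) ⟩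
          ℕ.sum (loads slow P)   ≡⟨ sum-balanced ℕ.≤-refl ⟩
          n ℕ.* Q                ∎)
          where open ≡-Reasoning
      module fast = SortedLoads (sortedLoads fast P)
      module slow = SortedLoads (sortedLoads slow P)
      good : ∀ {f} → TopKNorms (size ps) f →
        ∃[ x ] x ∈ vector fast ∷ vector slow ∷ [] × (∀ {y} → Feasible geometric y → f x ≤ fromℕ 2 * f y)
      -- The cut `2 * Q` is the bound on the sum of the processing times in `sum-powers`.
      good (top (suc k) _ k<d) with ℕ.≤-total (suc k) (2 ℕ.* Q)
      ... | inj₁ small = vector slow , there (here refl) , λ { (s , sum-s , refl) →
        let open SortedLoads (sortedLoads s P) in
        topNorm-≤ 2 (suc k) (sortedLoads slow P) (sortedLoads s P) (begin
          ℕ.sum (take (suc k) slow.ys)    ≤⟨ sum-take-≤-* (suc k) (Perm.All-resp-↭ (↭-sym slow.perm) slow-≤) ⟩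
          suc k ℕ.* Q                     ≤⟨ top-bound-small q 2≤q L k s sum-s perm sorted
                                               (ℕ.≤-trans k<d (ℕ.≤-reflexive (sym length-ys))) small ⟩
          2 ℕ.* ℕ.sum (take (suc k) ys)   ∎) }
        where open ℕ.≤-Reasoning
      ... | inj₂ large = vector fast , here refl , λ { (s , sum-s , refl) →
        let open SortedLoads (sortedLoads s P) in
        topNorm-≤ 2 (suc k) (sortedLoads fast P) (sortedLoads s P) (begin
          ℕ.sum (take (suc k) fast.ys)    ≤⟨ sum-take-≤ (suc k) fast.ys ⟩
          ℕ.sum fast.ys                   ≡⟨ sum-↭ fast.perm ⟩
          ℕ.sum (loads fast P)            ≡⟨ sum-balanced ℕ.z≤n ⟩
          n ℕ.* 1                         ≡⟨ ℕ.*-identityʳ n ⟩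
          n                               ≤⟨ top-bound-large q 2≤q L k s sum-s perm sorted
                                               (ℕ.≤-trans k<d (ℕ.≤-reflexive (sym length-ys))) large ⟩
          ℕ.sum (take (suc k) ys)         ≤⟨ ℕ.m≤n*m _ 2 ⟩
          2 ℕ.* ℕ.sum (take (suc k) ys)   ∎) }
        where open ℕ.≤-Reasoning

    -- The lower bound on portfolios for ordered norms.

    private
      -- What being within `b` of the schedule spread over group `j` entails: `total` comes from the
      -- sum part of the weighted norm, `light` from its maximum part.
      record GoodFor (b j : ℕ) (x : Vec Carrier (size ps)) : Set a where
        field
          s     : Vec ℕ (size ps)
          sum-s : Vec.sum s ≡ n
          x≡    : x ≡ vector s
          total : ℕ.sum (loads s P) ℕ.≤ b ℕ.* (2 ℕ.* (n ℕ.* q ℕ.^ j))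
          light : All (λ y → q ℕ.^ j ℕ.* y ℕ.≤ b ℕ.* (2 ℕ.* n)) (loads s P)

      module _ {α b X} (0≤α : 0# ≤ α) (α≤b : α ≤ fromℕ b)
               (X-portfolio : IsPortfolio geometric (OrderedNorms (size ps)) α X)
               {j} (j≤L : j ℕ.≤ L) where

        p N : ℕ
        p = q ℕ.^ j
        N = p ℕ.* p

        1≤N : 1 ℕ.≤ N
        1≤N = ℕ.*-mono-≤ (ℕ.m^n>0 q j) (ℕ.m^n>0 q j)

        w : Vec Carrier (size ps)
        w = Vec.map fromℕ (weight N (size ps))

        goodFor : ∃[ x ] x ∈ X × GoodFor b j x
        goodFor with IsPortfolio.approximate X-portfolio
                       -- The weight is nonzero because there is a machine: the slowest group alone
                       -- has `n` of them.
                       (ordered w (weight-isWeight 1≤N (ℕ.≤-trans 1≤n (ℕ.m≤m+n n _))))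
        ... | m , m* , m-min , m*-min , m≤αm* with IsMinimum.attained m-min
        ... | x , x∈X , refl with IsPortfolio.feasible X-portfolio x∈X
        ... | s , sum-s , refl = vector s , x∈X , record
          { s     = s
          ; sum-s = sum-s
          ; x≡    = refl
          ; total = subst (ℕ._≤ _) (sum-↭ perm) (ℕ.≤-trans (sum≤weighted 1≤N ys) good)
          ; light = Perm.All-resp-↭ perm (weighted-light {n = n} {b} (ℕ.m^n>0 q j) sorted good)
          }
          where
          open SortedLoads (sortedLoads s P)
          module y = SortedLoads (sortedLoads (balanced j≤L) P)
          v = 2 ℕ.* (n ℕ.* p)
          good : weighted N ys ℕ.≤ b ℕ.* v
          good = fromℕ-cancel-≤ (begin
            fromℕ (weighted N ys)                        ≡⟨ orderedNorm≡ N ⟨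
            orderedNorm w (vector s)                     ≤⟨ m≤αm* ⟩
            -- The optimum is at most the norm of the schedule spread over group `j`.
            α * m*                                       ≤⟨ *-monoˡ-≤ 0≤α (IsMinimum.lowerBound m*-min (balanced-feasible j≤L)) ⟩
            α * orderedNorm w (vector (balanced j≤L))    ≡⟨ cong (α *_) (y.orderedNorm≡ N) ⟩
            α * fromℕ (weighted N y.ys)                  ≤⟨ *-monoˡ-≤ 0≤α (fromℕ-mono-≤ (weighted-balanced j≤L y.perm)) ⟩
            α * fromℕ v                                  ≤⟨ *-monoʳ-≤ (0≤fromℕ v) α≤b ⟩
            fromℕ b * fromℕ v                            ≡⟨ fromℕ-* b v ⟨
            fromℕ (b ℕ.* v)                              ∎)
            where open import Relation.Binary.Reasoning.PartialOrder Order.poset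

      GoodFor-exclusive : ∀ {b i j x} → 6 ℕ.* b ℕ.< q → GoodFor b i x → GoodFor b j x → i ℕ.≮ j
      GoodFor-exclusive {b} 6b<q good-i good-j i<j = contradiction
        (unbalanced q 2≤q L {a = b} good-i.s good-i.sum-s 1≤n i<j good-i.total
          -- Both schedules represent the same vector `x`, so the load limit for `j` passes to the
          -- schedule whose total is bounded for `i`.
          (subst (All _) (loads-injective good-j.s good-i.s P (trans (sym good-j.x≡) good-i.x≡)) good-j.light))
        (ℕ.<⇒≱ 6b<q)
        where
        module good-i = GoodFor good-i
        module good-j = GoodFor good-j

    -- Pigeonhole: each of the `suc L` groups is sent to the position in `X` of a member serving it,
    -- and no member serves two groups.
    orderedPortfolio-size : ∀ {α b X} → 0# ≤ α → α ≤ fromℕ b → 6 ℕ.* b ℕ.< q →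
      IsPortfolio geometric (OrderedNorms (size ps)) α X → suc L ℕ.≤ length X
    orderedPortfolio-size {α} {b} {X} 0≤α α≤b 6b<q X-portfolio = Fin.injective⇒≤ index-member-injective
      where
      member : (i : Fin (suc L)) → ∃[ x ] x ∈ X × GoodFor b (toℕ i) x
      member i = goodFor 0≤α α≤b X-portfolio (Fin.toℕ≤pred[n] i)
      index-member-injective : ∀ {i j} → Any.index (proj₁ (proj₂ (member i))) ≡ Any.index (proj₁ (proj₂ (member j))) → i ≡ j
      index-member-injective {i} {j} eq with member i | member j
      ... | x , x∈X , good-i | y , y∈X , good-j with index-injective (setoid _) x∈X y∈X eq
      ... | refl with ℕ.<-cmp (toℕ i) (toℕ j)
      ... | tri< i<j _ _ = contradiction i<j (GoodFor-exclusive {b} 6b<q good-i good-j)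
      ... | tri≈ _ i≡j _ = Fin.toℕ-injective i≡j
      ... | tri> _ _ j<i = contradiction j<i (GoodFor-exclusive {b} 6b<q good-j good-i)

-- The growing family and the asymptotic lower bound.

theorem3 : ∀ {a ℓ} (R : ArchimedeanOrderedField a ℓ) →
    let open ArchimedeanOrderedField R
        open MLIJ R
        open Instance using (d)
    in
    Σ[ C ∈ Carrier ] Σ[ I ∈ (ℕ → Instance) ]
      (1# ≤ C)
      × (∀ N → ∃[ M ] (∀ m → M ℕ.≤ m → N ℕ.≤ d (I m)))
      × (∀ m → ∃[ X ] (IsPortfolio (I m) (TopKNorms (d (I m))) C X × length X ≡ 2))
      × (∀ α → 1# ≤ α →
           Σ[ c ∈ Carrier ] (0# < c) × (∃[ d₀ ] (∀ m → d₀ ℕ.≤ d (I m) →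
             ∀ X′ → IsPortfolio (I m) (OrderedNorms (d (I m))) α X′ →
             c * fromℕ ⌈log₂ d (I m) ⌉ ≤ fromℕ (length X′) * fromℕ ⌊log₂ ⌊log₂ d (I m) ⌋ ⌋)))
theorem3 R = fromℕ 2 , I , 1≤2 , (λ N → N , λ m N≤m → ℕ.≤-trans N≤m (m≤size m)) ,
    (λ m → _ , topPortfolio R _ _ (2≤2^suc m) (ℕ.m^n>0 2 (suc m)) , refl) , lower
  where
  open ArchimedeanOrderedField R
  open MLIJ R
  open Field R
  open import Relation.Binary.Reasoning.PartialOrder Order.poset

  I : ℕ → Instance
  I m = geometric R (2 ℕ.^ suc m) (2 ℕ.^ suc m) (2≤2^suc m)

  d : ℕ → ℕ
  d m = Instance.d (I m)

  1≤2 : 1# ≤ fromℕ 2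
  1≤2 = subst (_≤ fromℕ 2) (Ring.+-identityʳ 1#) (fromℕ-mono-≤ {1} {2} (ℕ.s≤s ℕ.z≤n))

  -- The quotient is cleared by multiplication. Rounding `log d` up and `log log d` down makes the
  -- integer inequality imply the one between the unrounded logarithms.
  lower : ∀ α → 1# ≤ α → Σ[ c ∈ Carrier ] (0# < c) × (∃[ d₀ ] (∀ m → d₀ ℕ.≤ d m →
    ∀ X′ → IsPortfolio (I m) (OrderedNorms (d m)) α X′ →
    c * fromℕ ⌈log₂ d m ⌉ ≤ fromℕ (length X′) * fromℕ ⌊log₂ ⌊log₂ d m ⌋ ⌋))
  -- `c` is one half, cancelling the factor 2 of `log-size`; `b` is a natural upper bound for `α`.
  lower α 1≤α with inverse (fromℕ 2) (λ 2≡0 → contradiction (fromℕ-injective {2} {0} 2≡0) λ ()) | archimedean α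
  -- From `d₀` on, `6 * b ≤ m`, and `m` is less than `q = 2 ^ suc m`.
  ... | c , 2c≡1 | b , α≤b with eventually d (6 ℕ.* b)
  ... | d₀ , large = c , (0≤c , 0≢c) , d₀ , λ m d₀≤d X′ X′-portfolio → bound m X′
      (orderedPortfolio-size R _ _ (2≤2^suc m) {b = b} (Order.trans 0≤1 1≤α) α≤b
        (ℕ.≤-<-trans (large m d₀≤d) (m<2^suc m)) X′-portfolio)
    where
    0≢c : 0# ≢ c
    0≢c refl = 0≢1 (trans (sym (Ring.zeroʳ (fromℕ 2))) 2c≡1)

    0≤c : 0# ≤ c
    0≤c with Order.total 0# c
    ... | inj₁ 0≤c = 0≤c
    ... | inj₂ c≤0 = contradiction (Order.antisym 0≤1 1≤0) 0≢1
      where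
      1≤0 : 1# ≤ 0#
      1≤0 = subst₂ _≤_ 2c≡1 (Ring.zeroʳ (fromℕ 2)) (*-monoˡ-≤ (0≤fromℕ 2) c≤0)

    bound : ∀ m X′ → suc (2 ℕ.^ suc m) ℕ.≤ length X′ →
            c * fromℕ ⌈log₂ d m ⌉ ≤ fromℕ (length X′) * fromℕ ⌊log₂ ⌊log₂ d m ⌋ ⌋
    bound m X′ L<l = begin
      c * fromℕ ⌈log₂ d m ⌉               ≤⟨ *-monoˡ-≤ 0≤c (fromℕ-mono-≤ (log-size m L<l)) ⟩
      c * fromℕ (2 ℕ.* (l ℕ.* loglog))    ≡⟨ cong (c *_) (fromℕ-* 2 (l ℕ.* loglog)) ⟩
      c * (fromℕ 2 * fromℕ (l ℕ.* loglog)) ≡⟨ Ring.*-assoc c (fromℕ 2) (fromℕ (l ℕ.* loglog)) ⟨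
      c * fromℕ 2 * fromℕ (l ℕ.* loglog)  ≡⟨ cong (_* fromℕ (l ℕ.* loglog)) (trans (Ring.*-comm c (fromℕ 2)) 2c≡1) ⟩
      1# * fromℕ (l ℕ.* loglog)           ≡⟨ Ring.*-identityˡ (fromℕ (l ℕ.* loglog)) ⟩
      fromℕ (l ℕ.* loglog)                ≡⟨ fromℕ-* l loglog ⟩
      fromℕ l * fromℕ loglog              ∎
      where
      l = length X′
      loglog = ⌊log₂ ⌊log₂ d m ⌋ ⌋
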